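{- Let $\mathbf{y}=(y_0,y_1,y_2)$ be a triple of positive integers with $y_0y_1y_2$ square-free, and let $r\geq 3$ be an integer. Then $$ \frac{N_{\mathbf{y}}^*(2^r)}{2^{2r}}=\begin{cases} 1, &\text{if } 2\nmid y_0y_1y_2 \text{ and it is not the case that } y_0 \equiv y_1 \equiv -y_2 \pmod 4,\\ 2, &\text{if } 2\mid y_0 \text{ and } y_1\equiv y_2 \pmod 8,\\ 2, &\text{if } 2\mid y_1 \text{ and } y_0\equiv y_2 \pmod 8,\\ 2, &\text{if } 2\mid y_2 \text{ and } y_0\equiv -y_1 \pmod 8,\\ 0, & \text{otherwise}. \end{cases} $$
   Context: For $r\geq 1$, $N_{\mathbf{y}}^*(2^r)$ is the number of $\mathbf{x}=(x_0,x_1,x_2)\in(\mathbf{Z}/2^r\mathbf{Z})^3\setminus(2\mathbf{Z}/2^r\mathbf{Z})^3$ such that $y_0^3x_0^2+y_1^3x_1^2\equiv y_2^3x_2^2\pmod{2^r}$ and $\min_{0\leq i\leq 2}\{v_2(x_iy_i)\}=0$, i.e. $2\nmid x_iy_i$ for at least one $i\in\{0,1,2\}$. -}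

module Defs where

open import Data.Fin.Base using (Fin; toℕ)
open import Data.Integer.Base as ℤ using (ℤ; +_)
open import Data.Integer.Divisibility.Signed as ℤ using ()
open import Data.List.Base using (List; allFin; cartesianProduct; filter; length)
open import Data.Nat.Base using (ℕ; _+_; _*_; _^_)
open import Data.Nat.Divisibility using (_∣_; _∤_; _∣?_)
open import Data.Nat.Properties using (m^n≢0)
open import Data.Product.Base using (_×_; _,_)
open import Data.Rational.Base using (ℚ; _/_)
open import Data.Sum.Base using (_⊎_)
open import Relation.Binary.PropositionalEquality.Core using (_≡_)
open import Relation.Nullary.Decidable.Core using (Dec; ¬?; _×-dec_; _⊎-dec_)
open import Relation.Nullary.Negation.Core using (¬_)

SquareFree : ℕ → Set
SquareFree n = ∀ d → d * d ∣ n → d ≡ 1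

infix 4 _≡_[mod_] _≡?_[mod_]

_≡_[mod_] : ℤ → ℤ → ℕ → Set
a ≡ b [mod n ] = (+ n) ℤ.∣ (a ℤ.- b)

_≡?_[mod_] : ∀ a b n → Dec (a ≡ b [mod n ])
a ≡? b [mod n ] = (+ n) ℤ.∣? (a ℤ.- b)

-- A residue class modulo m is represented by its element in {0, …, m - 1}.
Triple : ℕ → Set
Triple m = Fin m × Fin m × Fin m

allTriples : ∀ m → List (Triple m)
allTriples m = cartesianProduct (allFin m) (cartesianProduct (allFin m) (allFin m))

-- x ∈ (2ℤ/2^r)³.  For r ≥ 1 the parity of a class modulo 2^r is that of
-- its representative.
AllEven : ∀ {m} → Triple m → Set
AllEven (x₀ , x₁ , x₂) = 2 ∣ toℕ x₀ × 2 ∣ toℕ x₁ × 2 ∣ toℕ x₂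

module _ (y₀ y₁ y₂ : ℕ) where

  Equation : ∀ {m} → Triple m → Set
  Equation {m} (x₀ , x₁ , x₂) =
    + (y₀ ^ 3 * toℕ x₀ ^ 2 + y₁ ^ 3 * toℕ x₁ ^ 2) ≡ + (y₂ ^ 3 * toℕ x₂ ^ 2) [mod m ]

  -- min v₂(xᵢyᵢ) = 0, i.e. some xᵢyᵢ is odd.
  SomeOdd : ∀ {m} → Triple m → Set
  SomeOdd (x₀ , x₁ , x₂) =
    2 ∤ toℕ x₀ * y₀ ⊎ 2 ∤ toℕ x₁ * y₁ ⊎ 2 ∤ toℕ x₂ * y₂

  Counted : ∀ {m} → Triple m → Set
  Counted x = ¬ AllEven x × Equation x × SomeOdd x

  counted? : ∀ {m} (x : Triple m) → Dec (Counted x)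
  counted? {m} (x₀ , x₁ , x₂) =
    ¬? ((2 ∣? toℕ x₀) ×-dec (2 ∣? toℕ x₁) ×-dec (2 ∣? toℕ x₂))
    ×-dec (+ (y₀ ^ 3 * toℕ x₀ ^ 2 + y₁ ^ 3 * toℕ x₁ ^ 2) ≡? + (y₂ ^ 3 * toℕ x₂ ^ 2) [mod m ])
    ×-dec (¬? (2 ∣? toℕ x₀ * y₀) ⊎-dec ¬? (2 ∣? toℕ x₁ * y₁) ⊎-dec ¬? (2 ∣? toℕ x₂ * y₂))

  N* : ℕ → ℕ
  N* r = length (filter counted? (allTriples (2 ^ r)))

  N*/2^2r : ℕ → ℚ
  N*/2^2r r = _/_ (+ N* r) (2 ^ (2 * r)) {{m^n≢0 2 (2 * r)}}

  OddCase : Set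
  OddCase = 2 ∤ y₀ * y₁ * y₂
          × ¬ ((+ y₀ ≡ + y₁ [mod 4 ]) × (+ y₁ ≡ ℤ.- (+ y₂) [mod 4 ]))

  EvenCase₀ : Set
  EvenCase₀ = 2 ∣ y₀ × (+ y₁ ≡ + y₂ [mod 8 ])

  EvenCase₁ : Set
  EvenCase₁ = 2 ∣ y₁ × (+ y₀ ≡ + y₂ [mod 8 ])

  EvenCase₂ : Set
  EvenCase₂ = 2 ∣ y₂ × (+ y₀ ≡ ℤ.- (+ y₁) [mod 8 ])

{-# OPTIONS --safe #-}
module Submission where

-- Sort the counted triples by the first index i with xᵢyᵢ odd and fix the other two variables.
-- What remains is u x² + c ≡ 0 (mod 2^r) with u = ± yᵢ³ and x odd.  For r ≥ 3 its number of roots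
-- does not depend on r: with h = 2^(r-1), replacing x by x + h changes u x² + c by 2^r modulo 2^(r+1),
-- so exactly one of x and x + h stays a root modulo 2^(r+1), while x² modulo 2^(r+1) only depends on
-- x modulo 2^r.  Hence the inner count is that for r = 3, which is 8-periodic in the two outer
-- variables, and N*(2^r) = 4^(r-3) N*(8).  Finally N*(8) only depends on y modulo 8.

open import Defs
open import Data.Bool.Base using (if_then_else_)
open import Data.Empty using (⊥-elim)
open import Data.Fin.Base using (Fin; toℕ)
open import Data.Fin.Properties using (all?)
open import Data.Integer.Base as ℤ using (ℤ; +_)
import Data.Integer.Divisibility.Signed as ℤ
import Data.Integer.DivMod as ℤ
import Data.Integer.Properties as ℤ
import Data.Integer.Tactic.RingSolver as ℤ
open import Data.List.Base using (List; []; _∷_; _++_; allFin; cartesianProduct; filter; length; map; tabulate)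
open import Data.List.Properties using (filter-≐; map-++; map-cong; map-∘; map-tabulate)
open import Data.Nat.Base using (ℕ; zero; suc; _+_; _*_; _^_; _≤_; _<_; s≤s; z≤n; NonZero)
open import Data.Nat.Divisibility using (_∣_; _∤_; _∣?_; divides; ∣m∣n⇒∣m+n; ∣m+n∣m⇒∣n; ∣m⇒∣m*n; ∣n⇒∣m*n; *-pres-∣; ∣1⇒≡1)
open import Data.Nat.DivMod using (_divMod_; result)
open import Data.Nat.ListAction using (sum)
open import Data.Nat.ListAction.Properties using (sum-++)
open import Data.Nat.Primality using (euclidsLemma; prime[2])
open import Data.Nat.Properties
open import Data.Nat.Tactic.RingSolver using (solve-∀)
open import Data.Product.Base using (_×_; _,_; ∃; proj₁; proj₂)
open import Data.Product.Function.NonDependent.Propositional using (_×-⇔_)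
open import Data.Rational.Base using (_/_)
open import Data.Rational.Properties using (fromℚᵘ-cong)
open import Data.Rational.Unnormalised.Base using (mkℚᵘ; *≡*)
open import Data.Sum.Base as Sum using ([_,_]′)
open import Function.Base using (_∘_; const)
open import Function.Bundles using (_⇔_; mk⇔; module Equivalence)
open import Function.Construct.Identity using (⇔-id)
open import Function.Construct.Symmetry using (⇔-sym)
open import Function.Related.TypeIsomorphisms using (¬-cong-⇔)
open import Relation.Binary.PropositionalEquality
open import Relation.Nullary.Decidable using (Dec; yes; no; does; dec-true; dec-false; does-⇔; ¬?; _×-dec_; _⊎-dec_; _→-dec_; toWitness)
open import Relation.Nullary.Negation.Core using (¬_; contradiction)
open import Relation.Unary using (Decidable; Pred)
open ≡-Reasoning

private variable
  A B : Set
  P Q : Set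

-- Indicators and finite sums

-- Counts are rewritten as sums of indicators, so that splitting, pairing and reordering the counted
-- triples become identities between finite sums.
ind : Dec P → ℕ
ind p = if does p then 1 else 0

ind-yes : (p : Dec P) → P → ind p ≡ 1
ind-yes p x rewrite dec-true p x = refl

ind-no : (p : Dec P) → ¬ P → ind p ≡ 0
ind-no p ¬x rewrite dec-false p ¬x = refl

ind-cong : P ⇔ Q → (p : Dec P) (q : Dec Q) → ind p ≡ ind q
ind-cong eq p q rewrite does-⇔ eq p q = refl

Σ< : ℕ → (ℕ → ℕ) → ℕ
Σ< zero    f = 0
Σ< (suc n) f = f 0 + Σ< n (f ∘ suc)

Σ<-cong : ∀ n {f g : ℕ → ℕ} → (∀ x → f x ≡ g x) → Σ< n f ≡ Σ< n g
Σ<-cong zero    f≗g = refl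
Σ<-cong (suc n) f≗g = cong₂ _+_ (f≗g 0) (Σ<-cong n (f≗g ∘ suc))

Σ<-distrib-+ : ∀ n (f g : ℕ → ℕ) → Σ< n (λ x → f x + g x) ≡ Σ< n f + Σ< n g
Σ<-distrib-+ zero    f g = refl
Σ<-distrib-+ (suc n) f g = begin
  f 0 + g 0 + Σ< n (λ x → f (suc x) + g (suc x))       ≡⟨ cong₂ _+_ refl (Σ<-distrib-+ n _ _) ⟩
  f 0 + g 0 + (Σ< n (f ∘ suc) + Σ< n (g ∘ suc))        ≡⟨ +-interchange (f 0) (g 0) _ _ ⟩
  f 0 + Σ< n (f ∘ suc) + (g 0 + Σ< n (g ∘ suc))        ∎
  where
  +-interchange : ∀ a b c d → a + b + (c + d) ≡ a + c + (b + d)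
  +-interchange = solve-∀

Σ<-distribˡ-* : ∀ n k (f : ℕ → ℕ) → Σ< n (λ x → k * f x) ≡ k * Σ< n f
Σ<-distribˡ-* zero    k f = sym (*-zeroʳ k)
Σ<-distribˡ-* (suc n) k f = trans (cong₂ _+_ refl (Σ<-distribˡ-* n k (f ∘ suc))) (sym (*-distribˡ-+ k (f 0) _))

Σ<-zero : ∀ n → Σ< n (const 0) ≡ 0
Σ<-zero zero    = refl
Σ<-zero (suc n) = Σ<-zero n

Σ<-swap : ∀ m n (f : ℕ → ℕ → ℕ) → Σ< m (λ x → Σ< n (f x)) ≡ Σ< n (λ y → Σ< m (λ x → f x y))
Σ<-swap zero    n f = sym (Σ<-zero n)
Σ<-swap (suc m) n f = trans (cong₂ _+_ refl (Σ<-swap m n (f ∘ suc))) (sym (Σ<-distrib-+ n _ _))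

Σ<-split : ∀ m n (f : ℕ → ℕ) → Σ< (m + n) f ≡ Σ< m f + Σ< n (λ x → f (m + x))
Σ<-split zero    n f = refl
Σ<-split (suc m) n f = trans (cong₂ _+_ refl (Σ<-split m n (f ∘ suc))) (sym (+-assoc (f 0) _ _))

Periodic : ℕ → (ℕ → ℕ) → Set
Periodic p f = ∀ x → f (p + x) ≡ f x

Σ<-periodic : ∀ n p {f} → Periodic p f → Σ< (n * p) f ≡ n * Σ< p f
Σ<-periodic zero    p     f-per = refl
Σ<-periodic (suc n) p {f} f-per = begin
  Σ< (p + n * p) f                             ≡⟨ Σ<-split p (n * p) f ⟩
  Σ< p f + Σ< (n * p) (λ x → f (p + x))        ≡⟨ cong₂ _+_ refl (Σ<-cong (n * p) f-per) ⟩
  Σ< p f + Σ< (n * p) f                        ≡⟨ cong₂ _+_ refl (Σ<-periodic n p f-per) ⟩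
  Σ< p f + n * Σ< p f                          ∎

length-filter : {P : Pred A _} (P? : Decidable P) (xs : List A) →
  length (filter P? xs) ≡ sum (map (λ x → ind (P? x)) xs)
length-filter P? []       = refl
length-filter P? (x ∷ xs) with P? x
... | yes _ = cong suc (length-filter P? xs)
... | no  _ = length-filter P? xs

sum-cartesianProduct : (f : A × B → ℕ) (xs : List A) (ys : List B) →
  sum (map f (cartesianProduct xs ys)) ≡ sum (map (λ x → sum (map (λ y → f (x , y)) ys)) xs)
sum-cartesianProduct f []       ys = refl
sum-cartesianProduct f (x ∷ xs) ys = begin
  sum (map f (map (x ,_) ys ++ cartesianProduct xs ys))
    ≡⟨ cong sum (map-++ f (map (x ,_) ys) _) ⟩
  sum (map f (map (x ,_) ys) ++ map f (cartesianProduct xs ys))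
    ≡⟨ sum-++ (map f (map (x ,_) ys)) _ ⟩
  sum (map f (map (x ,_) ys)) + sum (map f (cartesianProduct xs ys))
    ≡⟨ cong₂ _+_ (cong sum (sym (map-∘ ys))) (sum-cartesianProduct f xs ys) ⟩
  _ ∎

sum-allFin : ∀ n (f : ℕ → ℕ) → sum (map (f ∘ toℕ) (allFin n)) ≡ Σ< n f
sum-allFin n f = trans (cong sum (map-tabulate {n = n} (λ i → i) (f ∘ toℕ))) (sum-tabulate n f)
  where
  sum-tabulate : ∀ n (f : ℕ → ℕ) → sum (tabulate {n = n} (f ∘ toℕ)) ≡ Σ< n f
  sum-tabulate zero    f = refl
  sum-tabulate (suc n) f = cong₂ _+_ refl (sum-tabulate n (f ∘ suc))

sum-allTriples : ∀ m (f : ℕ → ℕ → ℕ → ℕ) →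
  sum (map (λ (x₀ , x₁ , x₂) → f (toℕ x₀) (toℕ x₁) (toℕ x₂)) (allTriples m)) ≡
  Σ< m (λ x₀ → Σ< m (λ x₁ → Σ< m (f x₀ x₁)))
sum-allTriples m f = begin
  _ ≡⟨ sum-cartesianProduct _ (allFin m) (cartesianProduct (allFin m) (allFin m)) ⟩
  _ ≡⟨ cong sum (map-cong (λ x₀ → trans (sum-cartesianProduct _ (allFin m) (allFin m))
         (trans (cong sum (map-cong (λ x₁ → sum-allFin m (f (toℕ x₀) (toℕ x₁))) (allFin m)))
           (sum-allFin m (λ x₁ → Σ< m (f (toℕ x₀) x₁))))) (allFin m)) ⟩
  _ ≡⟨ sum-allFin m (λ x₀ → Σ< m (λ x₁ → Σ< m (f x₀ x₁))) ⟩
  _ ∎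

-- Divisibility

∣-shift : ∀ {m a b} k → b ≡ a + k * m → m ∣ a ⇔ m ∣ b
∣-shift {m} {a} k refl = mk⇔ (λ m∣a → ∣m∣n⇒∣m+n m∣a (divides k refl))
  (λ m∣b → ∣m+n∣m⇒∣n (subst (m ∣_) (+-comm a (k * m)) m∣b) (divides k refl))

∣ℤ-shift : ∀ {m a b} k → b ≡ a ℤ.+ k ℤ.* m → m ℤ.∣ a ⇔ m ℤ.∣ b
∣ℤ-shift k refl = mk⇔ (λ m∣a → ℤ.∣m∣n⇒∣m+n m∣a (ℤ.divides k refl))
  (λ m∣b → ℤ.∣m+n∣n⇒∣m m∣b (ℤ.divides k refl))

odd⇒≡1+2k : ∀ {a} → ¬ + 2 ℤ.∣ a → ∃ λ k → a ≡ + 1 ℤ.+ k ℤ.* + 2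
odd⇒≡1+2k {a} odd with a ℤ.% + 2 | ℤ.n%d<d a (+ 2) | ℤ.a≡a%n+[a/n]*n a (+ 2)
... | 0 | _ | eq = contradiction (ℤ.divides (a ℤ./ + 2) (trans eq (ℤ.+-identityˡ _))) odd
... | 1 | _ | eq = a ℤ./ + 2 , eq
... | suc (suc _) | s≤s (s≤s ()) | _

odd+odd : ∀ {a b} → ¬ + 2 ℤ.∣ a → ¬ + 2 ℤ.∣ b → + 2 ℤ.∣ a ℤ.+ b
odd+odd a-odd b-odd with odd⇒≡1+2k a-odd | odd⇒≡1+2k b-odd
... | j , refl | k , refl = ℤ.divides (+ 1 ℤ.+ j ℤ.+ k) (identity j k)
  where
  identity : ∀ j k → (+ 1 ℤ.+ j ℤ.* + 2) ℤ.+ (+ 1 ℤ.+ k ℤ.* + 2) ≡ (+ 1 ℤ.+ j ℤ.+ k) ℤ.* + 2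
  identity = ℤ.solve-∀

2∣⇔2m∣ : ∀ m .{{_ : NonZero m}} q → + 2 ℤ.∣ q ⇔ + (2 * m) ℤ.∣ q ℤ.* + m
2∣⇔2m∣ m q = mk⇔
  (λ d → subst (ℤ._∣ q ℤ.* + m) (sym (ℤ.pos-* 2 m)) (ℤ.*-monoˡ-∣ (+ m) d))
  (λ d → ℤ.*-cancelʳ-∣ (+ m) (subst (ℤ._∣ q ℤ.* + m) (ℤ.pos-* 2 m) d))

-- If a = q m, then b = (q + t) m. As t is odd, exactly one of q and q + t is even, so exactly one
-- of a and b is a multiple of 2m. If m does not divide a, it does not divide b either, and all
-- three indicators vanish.
ind-∣-halve : ∀ m .{{_ : NonZero m}} a b t → ¬ + 2 ℤ.∣ t → b ≡ a ℤ.+ t ℤ.* + m →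
  ind (+ (2 * m) ℤ.∣? a) + ind (+ (2 * m) ℤ.∣? b) ≡ ind (+ m ℤ.∣? a)
ind-∣-halve m a b t t-odd b≡a+tm = by-cases (+ m ℤ.∣? a)
  where
  m∣2m : + m ℤ.∣ + (2 * m)
  m∣2m = ℤ.divides (+ 2) (ℤ.pos-* 2 m)

  exactly-one : ∀ q → Dec (+ 2 ℤ.∣ q) → ind (+ 2 ℤ.∣? q) + ind (+ 2 ℤ.∣? (q ℤ.+ t)) ≡ 1
  exactly-one q (yes 2∣q) = cong₂ _+_ (ind-yes (+ 2 ℤ.∣? q) 2∣q)
    (ind-no (+ 2 ℤ.∣? (q ℤ.+ t)) (λ d → t-odd (ℤ.∣m+n∣m⇒∣n d 2∣q)))
  exactly-one q (no  2∤q) = cong₂ _+_ (ind-no (+ 2 ℤ.∣? q) 2∤q)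
    (ind-yes (+ 2 ℤ.∣? (q ℤ.+ t)) (odd+odd 2∤q t-odd))

  by-cases : Dec (+ m ℤ.∣ a) → ind (+ (2 * m) ℤ.∣? a) + ind (+ (2 * m) ℤ.∣? b) ≡ ind (+ m ℤ.∣? a)
  by-cases (no m∤a) = trans
    (cong₂ _+_ (ind-no (+ (2 * m) ℤ.∣? a) (λ d → m∤a (ℤ.∣-trans m∣2m d)))
      (ind-no (+ (2 * m) ℤ.∣? b) (λ d → m∤a (Equivalence.from (∣ℤ-shift t b≡a+tm) (ℤ.∣-trans m∣2m d)))))
    (sym (ind-no (+ m ℤ.∣? a) m∤a))
  by-cases (yes m∣a@(ℤ.divides q a≡qm)) = begin
    ind (+ (2 * m) ℤ.∣? a) + ind (+ (2 * m) ℤ.∣? b)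
      ≡⟨ cong₂ _+_ (ind-cong (2∣⇔2m∣′ q a≡qm) (+ 2 ℤ.∣? q) (+ (2 * m) ℤ.∣? a))
           (ind-cong (2∣⇔2m∣′ (q ℤ.+ t) b≡[q+t]m) (+ 2 ℤ.∣? (q ℤ.+ t)) (+ (2 * m) ℤ.∣? b)) ⟨
    ind (+ 2 ℤ.∣? q) + ind (+ 2 ℤ.∣? (q ℤ.+ t))
      ≡⟨ exactly-one q (+ 2 ℤ.∣? q) ⟩
    1
      ≡⟨ ind-yes (+ m ℤ.∣? a) m∣a ⟨
    ind (+ m ℤ.∣? a) ∎
    where
    2∣⇔2m∣′ : ∀ q {a} → a ≡ q ℤ.* + m → + 2 ℤ.∣ q ⇔ + (2 * m) ℤ.∣ a
    2∣⇔2m∣′ q refl = 2∣⇔2m∣ m q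
    b≡[q+t]m : b ≡ (q ℤ.+ t) ℤ.* + m
    b≡[q+t]m = trans b≡a+tm (trans (cong (ℤ._+ t ℤ.* + m) a≡qm) (sym (ℤ.*-distribʳ-+ (+ m) q t)))

-- Lifting square roots

-- The root x is required to make x * y odd; u will be ± y³.
Root : ℕ → ℕ → ℤ → ℤ → ℕ → Set
Root m y u c x = 2 ∤ x * y × + m ℤ.∣ u ℤ.* (+ x ℤ.* + x) ℤ.+ c

root? : ∀ m y u c x → Dec (Root m y u c x)
root? m y u c x = ¬? (2 ∣? x * y) ×-dec (+ m ℤ.∣? (u ℤ.* (+ x ℤ.* + x) ℤ.+ c))

#roots : ℕ → ℕ → ℤ → ℤ → ℕ
#roots r y u c = Σ< (2 ^ r) (λ x → ind (root? (2 ^ r) y u c x))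

2∣-shift : ∀ k x y → 2 ∣ (2 * k + x) * y ⇔ 2 ∣ x * y
2∣-shift k x y = ⇔-sym (∣-shift (k * y) (identity k x y))
  where
  identity : ∀ k x y → (2 * k + x) * y ≡ x * y + k * y * 2
  identity = solve-∀

-- Since (h + x)² - x² = 2hx + h², the two conditions on `m` keep the form fixed modulo `m`, and an
-- even `h` keeps the parity of x y. It is applied with `h` equal to half the modulus.
root?-periodic : ∀ m h y u c → 2 ∣ h → m ∣ 2 * h → m ∣ h * h → Periodic h (λ x → ind (root? m y u c x))
root?-periodic m h y u c 2∣h@(divides k h≡k*2) (divides i 2h≡i*m) (divides j h²≡j*m) x =
  ind-cong (¬-cong-⇔ parity ×-⇔ ⇔-sym (∣ℤ-shift (u ℤ.* (+ i ℤ.* + x ℤ.+ + j)) shifted))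
    (root? m y u c (h + x)) (root? m y u c x)
  where
  parity : 2 ∣ (h + x) * y ⇔ 2 ∣ x * y
  parity = subst (λ h → 2 ∣ (h + x) * y ⇔ 2 ∣ x * y) (trans (*-comm 2 k) (sym h≡k*2)) (2∣-shift k x y)

  expand : ∀ u h x c → u ℤ.* ((h ℤ.+ x) ℤ.* (h ℤ.+ x)) ℤ.+ c ≡
    u ℤ.* (x ℤ.* x) ℤ.+ c ℤ.+ u ℤ.* (+ 2 ℤ.* h ℤ.* x ℤ.+ h ℤ.* h)
  expand = ℤ.solve-∀

  collect : ∀ i j m x u → u ℤ.* (i ℤ.* m ℤ.* x ℤ.+ j ℤ.* m) ≡ u ℤ.* (i ℤ.* x ℤ.+ j) ℤ.* m
  collect = ℤ.solve-∀

  shifted : u ℤ.* (+ (h + x) ℤ.* + (h + x)) ℤ.+ c ≡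
    u ℤ.* (+ x ℤ.* + x) ℤ.+ c ℤ.+ u ℤ.* (+ i ℤ.* + x ℤ.+ + j) ℤ.* + m
  shifted = begin
    u ℤ.* (+ (h + x) ℤ.* + (h + x)) ℤ.+ c
      ≡⟨ expand u (+ h) (+ x) c ⟩
    u ℤ.* (+ x ℤ.* + x) ℤ.+ c ℤ.+ u ℤ.* (+ 2 ℤ.* + h ℤ.* + x ℤ.+ + h ℤ.* + h)
      ≡⟨ cong₂ (λ s t → u ℤ.* (+ x ℤ.* + x) ℤ.+ c ℤ.+ u ℤ.* (s ℤ.* + x ℤ.+ t))
           (lift 2 h i 2h≡i*m) (lift h h j h²≡j*m) ⟩
    u ℤ.* (+ x ℤ.* + x) ℤ.+ c ℤ.+ u ℤ.* (+ i ℤ.* + m ℤ.* + x ℤ.+ + j ℤ.* + m)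
      ≡⟨ cong (ℤ._+_ (u ℤ.* (+ x ℤ.* + x) ℤ.+ c)) (collect (+ i) (+ j) (+ m) (+ x) u) ⟩
    u ℤ.* (+ x ℤ.* + x) ℤ.+ c ℤ.+ u ℤ.* (+ i ℤ.* + x ℤ.+ + j) ℤ.* + m ∎
    where
    lift : ∀ a b c → a * b ≡ c * m → + a ℤ.* + b ≡ + c ℤ.* + m
    lift a b c eq = trans (sym (ℤ.pos-* a b)) (trans (cong +_ eq) (ℤ.pos-* c m))

-- (h + x)² = x² + 2hx + h² with 4h ∣ h², so modulo 4h the form changes by 2h times an odd number.
ind-root-halve : ∀ h .{{_ : NonZero h}} y u c → 4 ∣ h → (∀ x → 2 ∤ x * y → ¬ + 2 ℤ.∣ u ℤ.* + x) → ∀ x →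
  ind (root? (2 * (2 * h)) y u c x) + ind (root? (2 * (2 * h)) y u c (h + x)) ≡ ind (root? (2 * h) y u c x)
ind-root-halve h y u c 4∣h@(divides k h≡k*4) u-odd x = by-parity (2 ∣? x * y)
  where
  m = 2 * h
  form : ℕ → ℤ
  form x = u ℤ.* (+ x ℤ.* + x) ℤ.+ c
  parity : 2 ∣ (h + x) * y ⇔ 2 ∣ x * y
  parity = subst (λ h → 2 ∣ (h + x) * y ⇔ 2 ∣ x * y) (sym (trans h≡k*4 (identity k))) (2∣-shift (2 * k) x y)
    where
    identity : ∀ k → k * 4 ≡ 2 * (2 * k)
    identity = solve-∀
  -- With h = 4k, the increment u (2hx + h²) equals 2h (u x + 2 u k). This cofactor of 2h is odd
  -- because u x is.
  t = u ℤ.* + x ℤ.+ u ℤ.* + k ℤ.* + 2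
  expand : ∀ u k x c → u ℤ.* ((k ℤ.* + 4 ℤ.+ x) ℤ.* (k ℤ.* + 4 ℤ.+ x)) ℤ.+ c ≡
    u ℤ.* (x ℤ.* x) ℤ.+ c ℤ.+ (u ℤ.* x ℤ.+ u ℤ.* k ℤ.* + 2) ℤ.* (+ 2 ℤ.* (k ℤ.* + 4))
  expand = ℤ.solve-∀
  +h≡ : + h ≡ + k ℤ.* + 4
  +h≡ = trans (cong +_ h≡k*4) (ℤ.pos-* k 4)
  form-shift : form (h + x) ≡ form x ℤ.+ t ℤ.* + (2 * h)
  form-shift = begin
    u ℤ.* ((+ h ℤ.+ + x) ℤ.* (+ h ℤ.+ + x)) ℤ.+ c
      ≡⟨ cong (λ h → u ℤ.* ((h ℤ.+ + x) ℤ.* (h ℤ.+ + x)) ℤ.+ c) +h≡ ⟩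
    _ ≡⟨ expand u (+ k) (+ x) c ⟩
    form x ℤ.+ t ℤ.* (+ 2 ℤ.* (+ k ℤ.* + 4))
      ≡⟨ cong (λ h → form x ℤ.+ t ℤ.* h) (trans (cong (ℤ._*_ (+ 2)) (sym +h≡)) (sym (ℤ.pos-* 2 h))) ⟩
    form x ℤ.+ t ℤ.* + (2 * h) ∎

  root-even : ∀ m x → 2 ∣ x * y → ind (root? m y u c x) ≡ 0
  root-even m x even = ind-no (root? m y u c x) (λ (odd , _) → odd even)
  root-odd : ∀ m x → 2 ∤ x * y → ind (root? m y u c x) ≡ ind (+ m ℤ.∣? form x)
  root-odd m x odd = ind-cong (mk⇔ (λ (_ , d) → d) (odd ,_)) (root? m y u c x) (+ m ℤ.∣? form x)

  by-parity : Dec (2 ∣ x * y) →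
    ind (root? (2 * m) y u c x) + ind (root? (2 * m) y u c (h + x)) ≡ ind (root? m y u c x)
  by-parity (yes even) = trans
    (cong₂ _+_ (root-even (2 * m) x even) (root-even (2 * m) (h + x) (Equivalence.from parity even)))
    (sym (root-even m x even))
  by-parity (no odd) = begin
    ind (root? (2 * m) y u c x) + ind (root? (2 * m) y u c (h + x))
      ≡⟨ cong₂ _+_ (root-odd (2 * m) x odd) (root-odd (2 * m) (h + x) (odd ∘ Equivalence.to parity)) ⟩
    ind (+ (2 * m) ℤ.∣? form x) + ind (+ (2 * m) ℤ.∣? form (h + x))
      ≡⟨ ind-∣-halve m {{m*n≢0 2 h}} (form x) (form (h + x)) t
           (u-odd x odd ∘ Equivalence.from (∣ℤ-shift (u ℤ.* + k) refl)) form-shift ⟩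
    ind (+ m ℤ.∣? form x)
      ≡⟨ root-odd m x odd ⟨
    ind (root? m y u c x) ∎

-- Modulo 2m the indicator `g` has period m, so its sum is twice the sum over [0, m). There x is
-- paired with h + x, and each pair contributes `f x`, the indicator modulo m. As `f` has period h,
-- doubling its sum over [0, h) gives all roots modulo m.
#roots-suc : ∀ k y u c → (∀ x → 2 ∤ x * y → ¬ + 2 ℤ.∣ u ℤ.* + x) →
  #roots (4 + k) y u c ≡ #roots (3 + k) y u c
#roots-suc k y u c u-odd = begin
  Σ< (2 * m) g                    ≡⟨ Σ<-periodic 2 m g-periodic ⟩
  2 * Σ< (2 * h) g                ≡⟨ cong (λ n → 2 * Σ< n g) (cong (λ n → h + n) (+-identityʳ h)) ⟩
  2 * Σ< (h + h) g                ≡⟨ cong (2 *_) (trans (Σ<-split h h g) (sym (Σ<-distrib-+ h g (λ x → g (h + x))))) ⟩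
  2 * Σ< h (λ x → g x + g (h + x)) ≡⟨ cong (2 *_) (Σ<-cong h halve) ⟩
  2 * Σ< h f                      ≡⟨ Σ<-periodic 2 h f-periodic ⟨
  Σ< (2 * h) f                    ∎
  where
  h = 2 ^ (2 + k)
  m = 2 * h
  f g : ℕ → ℕ
  f x = ind (root? m y u c x)
  g x = ind (root? (2 * m) y u c x)
  2^[2+k] : ∀ n → 2 * (2 * n) ≡ n * 4
  2^[2+k] = solve-∀
  square : ∀ n → 2 * n * (2 * n) ≡ n * (2 * (2 * n))
  square = solve-∀
  halve : ∀ x → g x + g (h + x) ≡ f x
  -- The bound 3 on the exponent enters here: h is half of 2^(3 + k), hence a multiple of 4.
  halve = ind-root-halve h {{m^n≢0 2 (2 + k)}} y u c (divides (2 ^ k) (2^[2+k] (2 ^ k))) u-odd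
  g-periodic : Periodic m g
  g-periodic = root?-periodic (2 * m) m y u c (divides h (*-comm 2 h))
    (divides 1 (sym (*-identityˡ (2 * m)))) (divides h (square h))
  f-periodic : Periodic h f
  f-periodic = root?-periodic m h y u c (divides (2 * 2 ^ k) (*-comm 2 (2 * 2 ^ k)))
    (divides 1 (sym (*-identityˡ m))) (divides (2 * 2 ^ k) (square (2 * 2 ^ k)))

#roots-stable : ∀ k y u c → (∀ x → 2 ∤ x * y → ¬ + 2 ℤ.∣ u ℤ.* + x) →
  #roots (3 + k) y u c ≡ #roots 3 y u c
#roots-stable zero    y u c u-odd = refl
#roots-stable (suc k) y u c u-odd = trans (#roots-suc k y u c u-odd) (#roots-stable k y u c u-odd)

-- From 2^r to 8

#roots-3-cong : ∀ y u c k → #roots 3 y u (c ℤ.+ k ℤ.* + 8) ≡ #roots 3 y u c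
#roots-3-cong y u c k = Σ<-cong 8 λ x →
  ind-cong (⇔-id _ ×-⇔ ⇔-sym (∣ℤ-shift k (sym (ℤ.+-assoc (u ℤ.* (+ x ℤ.* + x)) c (k ℤ.* + 8)))))
    (root? 8 y u (c ℤ.+ k ℤ.* + 8) x) (root? 8 y u c x)

-- The contribution of the two fixed variables, which serves as the constant term c of the equation
-- for the third.
diag : ℤ → ℤ → ℕ → ℕ → ℤ
diag α β a b = α ℤ.* (+ a ℤ.* + a) ℤ.+ β ℤ.* (+ b ℤ.* + b)

-- The weight `w` will be the indicator that all products xⱼyⱼ preceding the chosen odd one are
-- even.
weighted#roots : ℕ → (ℕ → ℕ → ℕ) → ℕ → ℤ → ℤ → ℤ → ℕ
weighted#roots r w y u α β = Σ< (2 ^ r) λ a → Σ< (2 ^ r) λ b → w a b * #roots r y u (diag α β a b)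

-- The inner root count is already that for modulus 8, so the summand has period 8 in a and in b.
-- Each outer range consists of 2^k periods, which gives the factor 2^k twice.
weighted#roots-lift : ∀ k w y u α β →
  (∀ b → Periodic 8 (λ a → w a b)) → (∀ a → Periodic 8 (w a)) →
  (∀ x → 2 ∤ x * y → ¬ + 2 ℤ.∣ u ℤ.* + x) →
  weighted#roots (3 + k) w y u α β ≡ 2 ^ (2 * k) * weighted#roots 3 w y u α β
weighted#roots-lift k w y u α β w-per₁ w-per₂ u-odd = begin
  Σ< n (λ a → Σ< n λ b → w a b * #roots (3 + k) y u (diag α β a b))
    ≡⟨ Σ<-cong n (λ a → Σ<-cong n λ b → cong (w a b *_) (#roots-stable k y u (diag α β a b) u-odd)) ⟩
  Σ< n (λ a → Σ< n (F a))
    ≡⟨ Σ<-cong n (λ a → Σ<-8∣ (F a) (F-per₂ a)) ⟩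
  Σ< n (λ a → 2 ^ k * Σ< 8 (F a))
    ≡⟨ Σ<-distribˡ-* n (2 ^ k) (λ a → Σ< 8 (F a)) ⟩
  2 ^ k * Σ< n (λ a → Σ< 8 (F a))
    ≡⟨ cong (2 ^ k *_) (Σ<-8∣ (λ a → Σ< 8 (F a)) (λ a → Σ<-cong 8 (λ b → F-per₁ b a))) ⟩
  2 ^ k * (2 ^ k * Σ< 8 (λ a → Σ< 8 (F a)))
    ≡⟨ *-assoc (2 ^ k) (2 ^ k) _ ⟨
  2 ^ k * 2 ^ k * Σ< 8 (λ a → Σ< 8 (F a))
    ≡⟨ cong (_* Σ< 8 (λ a → Σ< 8 (F a))) (trans (cong (λ j → 2 ^ (k + j)) (+-identityʳ k)) (^-distribˡ-+-* 2 k k)) ⟨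
  2 ^ (2 * k) * Σ< 8 (λ a → Σ< 8 (F a)) ∎
  where
  n = 2 ^ (3 + k)
  F : ℕ → ℕ → ℕ
  F a b = w a b * #roots 3 y u (diag α β a b)

  Σ<-8∣ : ∀ f → Periodic 8 f → Σ< n f ≡ 2 ^ k * Σ< 8 f
  Σ<-8∣ f f-per = trans (cong (λ n → Σ< n f) (identity (2 ^ k))) (Σ<-periodic (2 ^ k) 8 f-per)
    where
    identity : ∀ n → 2 * (2 * (2 * n)) ≡ n * 8
    identity = solve-∀

  identity₁ : ∀ α a β → α ℤ.* ((+ 8 ℤ.+ a) ℤ.* (+ 8 ℤ.+ a)) ℤ.+ β ≡
    α ℤ.* (a ℤ.* a) ℤ.+ β ℤ.+ α ℤ.* (+ 2 ℤ.* a ℤ.+ + 8) ℤ.* + 8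
  identity₁ = ℤ.solve-∀
  identity₂ : ∀ α b β → α ℤ.+ β ℤ.* ((+ 8 ℤ.+ b) ℤ.* (+ 8 ℤ.+ b)) ≡
    α ℤ.+ β ℤ.* (b ℤ.* b) ℤ.+ β ℤ.* (+ 2 ℤ.* b ℤ.+ + 8) ℤ.* + 8
  identity₂ = ℤ.solve-∀

  F-per₁ : ∀ b → Periodic 8 (λ a → F a b)
  F-per₁ b a = cong₂ _*_ (w-per₁ b a) (trans (cong (#roots 3 y u) (identity₁ α (+ a) (β ℤ.* (+ b ℤ.* + b))))
    (#roots-3-cong y u (diag α β a b) (α ℤ.* (+ 2 ℤ.* + a ℤ.+ + 8))))
  F-per₂ : ∀ a → Periodic 8 (F a)
  F-per₂ a b = cong₂ _*_ (w-per₂ a b) (trans (cong (#roots 3 y u) (identity₂ (α ℤ.* (+ a ℤ.* + a)) (+ b) β))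
    (#roots-3-cong y u (diag α β a b) (β ℤ.* (+ 2 ℤ.* + b ℤ.+ + 8))))

even-periodic : ∀ y → Periodic 8 (λ x → ind (2 ∣? x * y))
even-periodic y x = ind-cong (2∣-shift 4 x y) (2 ∣? (8 + x) * y) (2 ∣? x * y)

-- Supplies the oddness hypothesis of the lifting lemmas for u = y³: the prime 2 dividing y³ x would
-- divide y or x.
odd-product : ∀ x y → 2 ∤ x * y → ¬ + 2 ℤ.∣ + (y ^ 3) ℤ.* + x
odd-product x y odd d = [ (λ 2∣y → odd (∣n⇒∣m*n x (2∣^⇒2∣ 3 2∣y))) , (λ 2∣x → odd (∣m⇒∣m*n y 2∣x)) ]′
  (euclidsLemma (y ^ 3) x prime[2] (ℤ.∣⇒∣ᵤ (subst (ℤ._∣_ (+ 2)) (sym (ℤ.pos-* (y ^ 3) x)) d)))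
  where
  2∣^⇒2∣ : ∀ n → 2 ∣ y ^ n → 2 ∣ y
  2∣^⇒2∣ zero    2∣1 = contradiction (∣1⇒≡1 2∣1) λ ()
  2∣^⇒2∣ (suc n) d   = [ (λ 2∣y → 2∣y) , 2∣^⇒2∣ n ]′ (euclidsLemma y (y ^ n) prime[2] d)

odd-product-neg : ∀ x y → 2 ∤ x * y → ¬ + 2 ℤ.∣ ℤ.- + (y ^ 3) ℤ.* + x
odd-product-neg x y odd d = odd-product x y odd
  (subst (ℤ._∣_ (+ 2)) (identity (+ (y ^ 3)) (+ x)) (ℤ.∣m⇒∣-m d))
  where
  identity : ∀ u x → ℤ.- (ℤ.- u ℤ.* x) ≡ u ℤ.* x
  identity = ℤ.solve-∀

-- Splitting the count by the first odd product

module _ (y₀ y₁ y₂ : ℕ) where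

  private
    Y₀ Y₁ -Y₂ : ℤ
    Y₀  = + (y₀ ^ 3)
    Y₁  = + (y₁ ^ 3)
    -Y₂ = ℤ.- + (y₂ ^ 3)

    even₀ even₁ : ℕ → ℕ
    even₀ x = ind (2 ∣? x * y₀)
    even₁ x = ind (2 ∣? x * y₁)

    -- Written exactly as the congruence in `Equation` unfolds, so that `counted?` tests its
    -- divisibility definitionally.
    residual : ℕ → ℕ → ℕ → ℤ
    residual x₀ x₁ x₂ = + (y₀ ^ 3 * x₀ ^ 2 + y₁ ^ 3 * x₁ ^ 2) ℤ.- + (y₂ ^ 3 * x₂ ^ 2)

    residual≡ : ∀ x₀ x₁ x₂ → residual x₀ x₁ x₂ ≡
      Y₀ ℤ.* (+ x₀ ℤ.* + x₀) ℤ.+ Y₁ ℤ.* (+ x₁ ℤ.* + x₁) ℤ.+ -Y₂ ℤ.* (+ x₂ ℤ.* + x₂)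
    residual≡ x₀ x₁ x₂ = cong₂ ℤ._+_ (cong₂ ℤ._+_ (square (y₀ ^ 3) x₀) (square (y₁ ^ 3) x₁))
      (trans (cong ℤ.-_ (square (y₂ ^ 3) x₂)) (ℤ.neg-distribˡ-* (+ (y₂ ^ 3)) (+ x₂ ℤ.* + x₂)))
      where
      square : ∀ u x → + (u * x ^ 2) ≡ + u ℤ.* (+ x ℤ.* + x)
      square u x = trans (ℤ.pos-* u (x ^ 2)) (cong (ℤ._*_ (+ u))
        (trans (cong (λ z → + (x * z)) (*-identityʳ x)) (ℤ.pos-* x x)))

    -- Counted triples, split according to the first i with xᵢyᵢ odd.
    split : ℕ → ℕ → ℕ → ℕ → ℕ
    split m x₀ x₁ x₂ =
      -- The factor 1 gives this term the same shape, weight times root indicator, as the other two.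
      (1 * ind (root? m y₀ Y₀ (diag Y₁ -Y₂ x₁ x₂) x₀)
      + even₀ x₀ * ind (root? m y₁ Y₁ (diag Y₀ -Y₂ x₀ x₂) x₁))
      + even₀ x₀ * even₁ x₁ * ind (root? m y₂ -Y₂ (diag Y₀ Y₁ x₀ x₁) x₂)

    ind-root : ∀ m x₀ x₁ x₂ y u c x → u ℤ.* (+ x ℤ.* + x) ℤ.+ c ≡ residual x₀ x₁ x₂ →
      ind (root? m y u c x) ≡ ind (¬? (2 ∣? x * y) ×-dec (+ m ℤ.∣? residual x₀ x₁ x₂))
    ind-root m x₀ x₁ x₂ y u c x eq = cong (λ z → ind (¬? (2 ∣? x * y) ×-dec (+ m ℤ.∣? z))) eq

    -- Abstract decisions reduce the splitting to a finite case check. On the right only the term of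
    -- the first failing `Oᵢ` can survive. If `¬ A` is refuted while some `Oᵢ` fails, there is a
    -- contradiction, because `A` would imply that `Oᵢ`.
    ind-first-no : ∀ {E O₀ O₁ O₂ A : Set}
      (¬A? : Dec (¬ A)) (e : Dec E) (v₀ : Dec O₀) (v₁ : Dec O₁) (v₂ : Dec O₂) → (A → O₀ × O₁ × O₂) →
      ind (¬A? ×-dec e ×-dec (¬? v₀ ⊎-dec ¬? v₁ ⊎-dec ¬? v₂)) ≡
      (1 * ind (¬? v₀ ×-dec e) + ind v₀ * ind (¬? v₁ ×-dec e)) + ind v₀ * ind v₁ * ind (¬? v₂ ×-dec e)
    ind-first-no (yes _) (yes _) (no _)  _       _       _ = refl
    ind-first-no (yes _) (yes _) (yes _) (no _)  _       _ = refl
    ind-first-no (yes _) (yes _) (yes _) (yes _) (no _)  _ = refl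
    ind-first-no (yes _) (yes _) (yes _) (yes _) (yes _) _ = refl
    ind-first-no (yes _) (no _)  (no _)  _       _       _ = refl
    ind-first-no (yes _) (no _)  (yes _) (no _)  _       _ = refl
    ind-first-no (yes _) (no _)  (yes _) (yes _) (no _)  _ = refl
    ind-first-no (yes _) (no _)  (yes _) (yes _) (yes _) _ = refl
    ind-first-no (no ¬¬a) e      (no ¬o) _       _       f = ⊥-elim (¬¬a (λ a → ¬o (proj₁ (f a))))
    ind-first-no (no ¬¬a) e      (yes _) (no ¬o) _       f = ⊥-elim (¬¬a (λ a → ¬o (proj₁ (proj₂ (f a)))))
    ind-first-no (no ¬¬a) e      (yes _) (yes _) (no ¬o) f = ⊥-elim (¬¬a (λ a → ¬o (proj₂ (proj₂ (f a)))))
    ind-first-no (no _)  (yes _) (yes _) (yes _) (yes _) _ = refl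
    ind-first-no (no _)  (no _)  (yes _) (yes _) (yes _) _ = refl

    ind-counted : ∀ {m} (x₀ x₁ x₂ : Fin m) →
      ind (counted? y₀ y₁ y₂ (x₀ , x₁ , x₂)) ≡ split m (toℕ x₀) (toℕ x₁) (toℕ x₂)
    ind-counted {m} i₀ i₁ i₂ = trans
      (ind-first-no (¬? ((2 ∣? x₀) ×-dec (2 ∣? x₁) ×-dec (2 ∣? x₂))) (+ m ℤ.∣? residual x₀ x₁ x₂)
        (2 ∣? x₀ * y₀) (2 ∣? x₁ * y₁) (2 ∣? x₂ * y₂)
        (λ (d₀ , d₁ , d₂) → ∣m⇒∣m*n y₀ d₀ , ∣m⇒∣m*n y₁ d₁ , ∣m⇒∣m*n y₂ d₂))
      (sym (cong₂ _+_ (cong₂ _+_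
        (cong (1 *_) (ind-root m x₀ x₁ x₂ y₀ Y₀ (diag Y₁ -Y₂ x₁ x₂) x₀
          (trans (sym (ℤ.+-assoc s₀ s₁ s₂)) (sym (residual≡ x₀ x₁ x₂)))))
        (cong (even₀ x₀ *_) (ind-root m x₀ x₁ x₂ y₁ Y₁ (diag Y₀ -Y₂ x₀ x₂) x₁
          (trans (rearrange₁ s₀ s₁ s₂) (sym (residual≡ x₀ x₁ x₂))))))
        (cong (even₀ x₀ * even₁ x₁ *_) (ind-root m x₀ x₁ x₂ y₂ -Y₂ (diag Y₀ Y₁ x₀ x₁) x₂
          (trans (ℤ.+-comm s₂ (s₀ ℤ.+ s₁)) (sym (residual≡ x₀ x₁ x₂)))))))
      where
      x₀ = toℕ i₀
      x₁ = toℕ i₁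
      x₂ = toℕ i₂
      s₀ = Y₀ ℤ.* (+ x₀ ℤ.* + x₀)
      s₁ = Y₁ ℤ.* (+ x₁ ℤ.* + x₁)
      s₂ = -Y₂ ℤ.* (+ x₂ ℤ.* + x₂)
      rearrange₁ : ∀ a b c → b ℤ.+ (a ℤ.+ c) ≡ a ℤ.+ b ℤ.+ c
      rearrange₁ = ℤ.solve-∀

    w₀ w₁ w₂ : ℕ → ℕ → ℕ
    w₀ _ _ = 1
    w₁ x₀ _ = even₀ x₀
    w₂ x₀ x₁ = even₀ x₀ * even₁ x₁

  -- The three terms of `split` are summed separately. In each, the order of summation is changed
  -- until the variable tested by `root?` is innermost, and the weight is then constant in the inner
  -- sum and factors out.
  N*-split : ∀ r → N* y₀ y₁ y₂ r ≡
    (weighted#roots r w₀ y₀ Y₀ Y₁ -Y₂ + weighted#roots r w₁ y₁ Y₁ Y₀ -Y₂) + weighted#roots r w₂ y₂ -Y₂ Y₀ Y₁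
  N*-split r = begin
    N* y₀ y₁ y₂ r
      ≡⟨ length-filter (counted? y₀ y₁ y₂) (allTriples n) ⟩
    sum (map (λ x → ind (counted? y₀ y₁ y₂ x)) (allTriples n))
      ≡⟨ cong sum (map-cong (λ (x₀ , x₁ , x₂) → ind-counted x₀ x₁ x₂) (allTriples n)) ⟩
    sum (map (λ (x₀ , x₁ , x₂) → split n (toℕ x₀) (toℕ x₁) (toℕ x₂)) (allTriples n))
      ≡⟨ sum-allTriples n (split n) ⟩
    Σ³ (λ x₀ x₁ x₂ → (p x₀ x₁ x₂ + q x₀ x₁ x₂) + s x₀ x₁ x₂)
      ≡⟨ trans (Σ³-distrib-+ (λ x₀ x₁ x₂ → p x₀ x₁ x₂ + q x₀ x₁ x₂) s)
           (cong (λ z → z + Σ³ s) (Σ³-distrib-+ p q)) ⟩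
    (Σ³ p + Σ³ q) + Σ³ s
      ≡⟨ cong₂ _+_ (cong₂ _+_ p-sum q-sum) s-sum ⟩
    _ ∎
    where
    n = 2 ^ r
    Σ³ : (ℕ → ℕ → ℕ → ℕ) → ℕ
    Σ³ f = Σ< n λ x₀ → Σ< n λ x₁ → Σ< n (f x₀ x₁)

    Σ³-distrib-+ : ∀ f g → Σ³ (λ x₀ x₁ x₂ → f x₀ x₁ x₂ + g x₀ x₁ x₂) ≡ Σ³ f + Σ³ g
    Σ³-distrib-+ f g = trans
      (Σ<-cong n (λ x₀ → trans (Σ<-cong n (λ x₁ → Σ<-distrib-+ n (f x₀ x₁) (g x₀ x₁)))
        (Σ<-distrib-+ n (λ x₁ → Σ< n (f x₀ x₁)) (λ x₁ → Σ< n (g x₀ x₁)))))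
      (Σ<-distrib-+ n (λ x₀ → Σ< n (λ x₁ → Σ< n (f x₀ x₁))) (λ x₀ → Σ< n (λ x₁ → Σ< n (g x₀ x₁))))

    p q s : ℕ → ℕ → ℕ → ℕ
    p x₀ x₁ x₂ = 1 * ind (root? n y₀ Y₀ (diag Y₁ -Y₂ x₁ x₂) x₀)
    q x₀ x₁ x₂ = even₀ x₀ * ind (root? n y₁ Y₁ (diag Y₀ -Y₂ x₀ x₂) x₁)
    s x₀ x₁ x₂ = even₀ x₀ * even₁ x₁ * ind (root? n y₂ -Y₂ (diag Y₀ Y₁ x₀ x₁) x₂)

    s-sum : Σ³ s ≡ weighted#roots r w₂ y₂ -Y₂ Y₀ Y₁
    s-sum = Σ<-cong n λ x₀ → Σ<-cong n λ x₁ → Σ<-distribˡ-* n (w₂ x₀ x₁) _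

    q-sum : Σ³ q ≡ weighted#roots r w₁ y₁ Y₁ Y₀ -Y₂
    q-sum = Σ<-cong n λ x₀ → trans (Σ<-swap n n (q x₀)) (Σ<-cong n λ x₂ → Σ<-distribˡ-* n (w₁ x₀ x₂) _)

    p-sum : Σ³ p ≡ weighted#roots r w₀ y₀ Y₀ Y₁ -Y₂
    p-sum = trans (Σ<-swap n n (λ x₀ x₁ → Σ< n (p x₀ x₁)))
      (Σ<-cong n λ x₁ → trans (Σ<-swap n n (λ x₀ → p x₀ x₁)) (Σ<-cong n λ x₂ → Σ<-distribˡ-* n (w₀ x₁ x₂) _))

  N*-lift : ∀ k → N* y₀ y₁ y₂ (3 + k) ≡ 2 ^ (2 * k) * N* y₀ y₁ y₂ 3
  N*-lift k = begin
    N* y₀ y₁ y₂ (3 + k)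
      ≡⟨ N*-split (3 + k) ⟩
    _ ≡⟨ cong₂ _+_ (cong₂ _+_
           (weighted#roots-lift k w₀ y₀ Y₀ Y₁ -Y₂ (λ _ _ → refl) (λ _ _ → refl) (λ x → odd-product x y₀))
           (weighted#roots-lift k w₁ y₁ Y₁ Y₀ -Y₂ (λ _ → even-periodic y₀) (λ _ _ → refl) (λ x → odd-product x y₁)))
           (weighted#roots-lift k w₂ y₂ -Y₂ Y₀ Y₁
             (λ b a → cong (_* even₁ b) (even-periodic y₀ a)) (λ a b → cong (even₀ a *_) (even-periodic y₁ b))
             (λ x → odd-product-neg x y₂)) ⟩
    (2 ^ (2 * k) * A₀ + 2 ^ (2 * k) * A₁) + 2 ^ (2 * k) * A₂
      ≡⟨ trans (*-distribˡ-+ (2 ^ (2 * k)) (A₀ + A₁) A₂) (cong (λ z → z + 2 ^ (2 * k) * A₂) (*-distribˡ-+ (2 ^ (2 * k)) A₀ A₁)) ⟨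
    2 ^ (2 * k) * ((A₀ + A₁) + A₂)
      ≡⟨ cong (2 ^ (2 * k) *_) (N*-split 3) ⟨
    2 ^ (2 * k) * N* y₀ y₁ y₂ 3 ∎
    where
    A₀ = weighted#roots 3 w₀ y₀ Y₀ Y₁ -Y₂
    A₁ = weighted#roots 3 w₁ y₁ Y₁ Y₀ -Y₂
    A₂ = weighted#roots 3 w₂ y₂ -Y₂ Y₀ Y₁

-- Reduction of y modulo 8

-- A record, so that Agda can infer a and b from a proof of the congruence.
record _≈_[_] (a b : ℤ) (n : ℕ) : Set where
  constructor ⟨_⟩
  field congruence : a ≡ b [mod n ]

open _≈_[_]

infix 4 _≈_[_]

module _ {n : ℕ} where

  ≈-refl : ∀ {a} → a ≈ a [ n ]
  ≈-refl {a} = ⟨ ℤ.divides (+ 0) (ℤ.+-inverseʳ a) ⟩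

  ≈-sym : ∀ {a b} → a ≈ b [ n ] → b ≈ a [ n ]
  ≈-sym {a} {b} ⟨ d ⟩ = ⟨ subst (ℤ._∣_ (+ n)) (identity a b) (ℤ.∣m⇒∣-m d) ⟩
    where
    identity : ∀ a b → ℤ.- (a ℤ.- b) ≡ b ℤ.- a
    identity = ℤ.solve-∀

  ≈-trans : ∀ {a b c} → a ≈ b [ n ] → b ≈ c [ n ] → a ≈ c [ n ]
  ≈-trans {a} {b} {c} ⟨ d ⟩ ⟨ e ⟩ = ⟨ subst (ℤ._∣_ (+ n)) (identity a b c) (ℤ.∣m∣n⇒∣m+n d e) ⟩
    where
    identity : ∀ a b c → (a ℤ.- b) ℤ.+ (b ℤ.- c) ≡ a ℤ.- c
    identity = ℤ.solve-∀

  ≈-resp₂ : ∀ {a b c d} → a ≈ b [ n ] → c ≈ d [ n ] → a ≡ c [mod n ] → b ≡ d [mod n ]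
  ≈-resp₂ a≈b c≈d a≡c = congruence (≈-trans (≈-sym a≈b) (≈-trans ⟨ a≡c ⟩ c≈d))

  ≈-+ : ∀ {a b c d} → a ≈ b [ n ] → c ≈ d [ n ] → a ℤ.+ c ≈ b ℤ.+ d [ n ]
  ≈-+ {a} {b} {c} {d} ⟨ e ⟩ ⟨ f ⟩ = ⟨ subst (ℤ._∣_ (+ n)) (identity a b c d) (ℤ.∣m∣n⇒∣m+n e f) ⟩
    where
    identity : ∀ a b c d → (a ℤ.- b) ℤ.+ (c ℤ.- d) ≡ a ℤ.+ c ℤ.- (b ℤ.+ d)
    identity = ℤ.solve-∀

  ≈-neg : ∀ {a b} → a ≈ b [ n ] → ℤ.- a ≈ ℤ.- b [ n ]
  ≈-neg {a} {b} ⟨ d ⟩ = ⟨ subst (ℤ._∣_ (+ n)) (identity a b) (ℤ.∣m⇒∣-m d) ⟩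
    where
    identity : ∀ a b → ℤ.- (a ℤ.- b) ≡ ℤ.- a ℤ.- ℤ.- b
    identity = ℤ.solve-∀

  ≈-* : ∀ {a b c d : ℕ} → + a ≈ + b [ n ] → + c ≈ + d [ n ] → + (a * c) ≈ + (b * d) [ n ]
  ≈-* {a} {b} {c} {d} ⟨ e ⟩ ⟨ f ⟩ =
    subst₂ (λ i j → i ≈ j [ n ]) (sym (ℤ.pos-* a c)) (sym (ℤ.pos-* b d))
      ⟨ subst (ℤ._∣_ (+ n)) (identity (+ a) (+ b) (+ c) (+ d))
          (ℤ.∣m∣n⇒∣m+n (ℤ.∣m⇒∣m*n (+ c) e) (ℤ.∣n⇒∣m*n (+ b) f)) ⟩
    where
    identity : ∀ a b c d → (a ℤ.- b) ℤ.* c ℤ.+ b ℤ.* (c ℤ.- d) ≡ a ℤ.* c ℤ.- b ℤ.* d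
    identity = ℤ.solve-∀

  ≈-^ : ∀ {a b : ℕ} k → + a ≈ + b [ n ] → + (a ^ k) ≈ + (b ^ k) [ n ]
  ≈-^ zero    e = ≈-refl
  ≈-^ (suc k) e = ≈-* e (≈-^ k e)

  ∣-resp-≈ : ∀ {a b} → + a ≈ + b [ n ] → n ∣ a → n ∣ b
  ∣-resp-≈ {a} {b} ⟨ e ⟩ n∣a =
    ℤ.∣⇒∣ᵤ (subst (ℤ._∣_ (+ n)) (identity (+ a) (+ b)) (ℤ.∣m∣n⇒∣m-n {m = + a} (ℤ.∣ᵤ⇒∣ n∣a) e))
    where
    identity : ∀ a b → a ℤ.- (a ℤ.- b) ≡ b
    identity = ℤ.solve-∀

≈-weaken : ∀ {m n a b} → m ∣ n → a ≈ b [ n ] → a ≈ b [ m ]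
≈-weaken m∣n ⟨ d ⟩ = ⟨ ℤ.∣-trans (ℤ.∣ᵤ⇒∣ m∣n) d ⟩

residue : ∀ y → ∃ λ (i : Fin 8) → + y ≈ + toℕ i [ 8 ]
residue y with y divMod 8
... | result q i y≡i+q*8 = i , ⟨ ℤ.divides (+ q) (begin
  + y ℤ.- + toℕ i                                ≡⟨ cong (λ z → + z ℤ.- + toℕ i) y≡i+q*8 ⟩
  + toℕ i ℤ.+ + (q * 8) ℤ.- + toℕ i              ≡⟨ identity (+ toℕ i) (+ (q * 8)) ⟩
  + (q * 8)                                      ≡⟨ ℤ.pos-* q 8 ⟩
  + q ℤ.* + 8                                    ∎) ⟩
  where
  identity : ∀ i q → i ℤ.+ q ℤ.- i ≡ q
  identity = ℤ.solve-∀

-- The case distinction and its check modulo 8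

AtMostOneEven : ℕ → ℕ → ℕ → Set
AtMostOneEven a b c = ¬ (2 ∣ a × 2 ∣ b) × ¬ (2 ∣ a × 2 ∣ c) × ¬ (2 ∣ b × 2 ∣ c)

-- Two even factors would make 4 divide the product. Unlike square-freeness, the conclusion depends
-- only on residues modulo 8, so it can be assumed in a finite check.
squareFree⇒atMostOneEven : ∀ a b c → SquareFree (a * b * c) → AtMostOneEven a b c
squareFree⇒atMostOneEven a b c sf =
    (λ (2∣a , 2∣b) → 4∤abc (∣m⇒∣m*n c (*-pres-∣ 2∣a 2∣b)))
  , (λ (2∣a , 2∣c) → 4∤abc (*-pres-∣ (∣m⇒∣m*n b 2∣a) 2∣c))
  , (λ (2∣b , 2∣c) → 4∤abc (*-pres-∣ (∣n⇒∣m*n a 2∣b) 2∣c))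
  where
  4∤abc : 2 * 2 ∤ a * b * c
  4∤abc d = contradiction (sf 2 d) λ ()

-- The case distinction of the theorem for a bare count `n`, with `u` in the place of the
-- denominator 2^(2r).
CountIs : ℕ → ℕ → ℕ → ℕ → ℕ → Set
CountIs u n y₀ y₁ y₂ =
    (OddCase y₀ y₁ y₂ → n ≡ u)
  × (EvenCase₀ y₀ y₁ y₂ → n ≡ 2 * u)
  × (EvenCase₁ y₀ y₁ y₂ → n ≡ 2 * u)
  × (EvenCase₂ y₀ y₁ y₂ → n ≡ 2 * u)
  × (¬ OddCase y₀ y₁ y₂ → ¬ EvenCase₀ y₀ y₁ y₂ → ¬ EvenCase₁ y₀ y₁ y₂ → ¬ EvenCase₂ y₀ y₁ y₂ → n ≡ 0)

countIs? : ∀ u n y₀ y₁ y₂ → Dec (CountIs u n y₀ y₁ y₂)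
countIs? u n y₀ y₁ y₂ =
  (odd →-dec (n ≟ u)) ×-dec (even₀ →-dec (n ≟ 2 * u)) ×-dec (even₁ →-dec (n ≟ 2 * u))
  ×-dec (even₂ →-dec (n ≟ 2 * u)) ×-dec (¬? odd →-dec ¬? even₀ →-dec ¬? even₁ →-dec ¬? even₂ →-dec (n ≟ 0))
  where
  odd   = ¬? (2 ∣? y₀ * y₁ * y₂) ×-dec ¬? ((+ y₀ ≡? + y₁ [mod 4 ]) ×-dec (+ y₁ ≡? ℤ.- + y₂ [mod 4 ]))
  even₀ = (2 ∣? y₀) ×-dec (+ y₁ ≡? + y₂ [mod 8 ])
  even₁ = (2 ∣? y₁) ×-dec (+ y₀ ≡? + y₂ [mod 8 ])
  even₂ = (2 ∣? y₂) ×-dec (+ y₀ ≡? ℤ.- + y₁ [mod 8 ])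

-- Decided by evaluation over all 512 triples of residues; 64 is 2^(2r) for r = 3.
N*-residues : (i j k : Fin 8) → AtMostOneEven (toℕ i) (toℕ j) (toℕ k) →
  CountIs 64 (N* (toℕ i) (toℕ j) (toℕ k) 3) (toℕ i) (toℕ j) (toℕ k)
N*-residues = toWitness {a? = all? λ i → all? λ j → all? λ k →
  (¬? ((2 ∣? toℕ i) ×-dec (2 ∣? toℕ j)) ×-dec ¬? ((2 ∣? toℕ i) ×-dec (2 ∣? toℕ k))
    ×-dec ¬? ((2 ∣? toℕ j) ×-dec (2 ∣? toℕ k)))
  →-dec countIs? 64 (N* (toℕ i) (toℕ j) (toℕ k) 3) (toℕ i) (toℕ j) (toℕ k)} _

-- Each implication is proved in one direction; the converse, where needed, comes from exchanging y
-- and z through `≈-sym`. `AtMostOneEven` and `OddCase` pass from z to y because they consist of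
-- negations.
module _ {y₀ y₁ y₂ z₀ z₁ z₂ : ℕ}
  (e₀ : + y₀ ≈ + z₀ [ 8 ]) (e₁ : + y₁ ≈ + z₁ [ 8 ]) (e₂ : + y₂ ≈ + z₂ [ 8 ]) where

  private
    2∣8 : 2 ∣ 8
    2∣8 = divides 4 refl
    4∣8 : 4 ∣ 8
    4∣8 = divides 2 refl
    e₀′ = ≈-weaken 2∣8 e₀
    e₁′ = ≈-weaken 2∣8 e₁
    e₂′ = ≈-weaken 2∣8 e₂

  atMostOneEven-resp : AtMostOneEven z₀ z₁ z₂ → AtMostOneEven y₀ y₁ y₂
  atMostOneEven-resp (¬01 , ¬02 , ¬12) =
      (λ (d , d′) → ¬01 (∣-resp-≈ e₀′ d , ∣-resp-≈ e₁′ d′))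
    , (λ (d , d′) → ¬02 (∣-resp-≈ e₀′ d , ∣-resp-≈ e₂′ d′))
    , (λ (d , d′) → ¬12 (∣-resp-≈ e₁′ d , ∣-resp-≈ e₂′ d′))

  oddCase-resp : OddCase z₀ z₁ z₂ → OddCase y₀ y₁ y₂
  oddCase-resp (odd , ¬same) =
      odd ∘ ∣-resp-≈ (≈-* (≈-* e₀′ e₁′) e₂′)
    , λ (y₀≡y₁ , y₁≡-y₂) → ¬same (≈-resp₂ e₀″ e₁″ y₀≡y₁ , ≈-resp₂ e₁″ (≈-neg e₂″) y₁≡-y₂)
    where
    e₀″ = ≈-weaken 4∣8 e₀
    e₁″ = ≈-weaken 4∣8 e₁
    e₂″ = ≈-weaken 4∣8 e₂

  evenCase₀-resp : EvenCase₀ y₀ y₁ y₂ → EvenCase₀ z₀ z₁ z₂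
  evenCase₀-resp (even , e) = ∣-resp-≈ e₀′ even , ≈-resp₂ e₁ e₂ e

  evenCase₁-resp : EvenCase₁ y₀ y₁ y₂ → EvenCase₁ z₀ z₁ z₂
  evenCase₁-resp (even , e) = ∣-resp-≈ e₁′ even , ≈-resp₂ e₀ e₂ e

  evenCase₂-resp : EvenCase₂ y₀ y₁ y₂ → EvenCase₂ z₀ z₁ z₂
  evenCase₂-resp (even , e) = ∣-resp-≈ e₂′ even , ≈-resp₂ e₀ (≈-neg e₁) e

  counted-resp : ∀ {x : Triple 8} → Counted y₀ y₁ y₂ x → Counted z₀ z₁ z₂ x
  counted-resp {x₀ , x₁ , x₂} (¬even , e , odd) =
    ¬even ,
    ≈-resp₂ (≈-+ (term e₀ x₀) (term e₁ x₁)) (term e₂ x₂) e ,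
    Sum.map (parity e₀′ x₀) (Sum.map (parity e₁′ x₁) (parity e₂′ x₂)) odd
    where
    term : ∀ {y z} → + y ≈ + z [ 8 ] → (x : Fin 8) → + (y ^ 3 * toℕ x ^ 2) ≈ + (z ^ 3 * toℕ x ^ 2) [ 8 ]
    term e x = ≈-* (≈-^ 3 e) ≈-refl
    parity : ∀ {y z} → + y ≈ + z [ 2 ] → (x : Fin 8) → 2 ∤ toℕ x * y → 2 ∤ toℕ x * z
    parity e x odd = odd ∘ ∣-resp-≈ (≈-* (≈-refl {a = + toℕ x}) (≈-sym e))

module _ {y₀ y₁ y₂ z₀ z₁ z₂ : ℕ}
  (e₀ : + y₀ ≈ + z₀ [ 8 ]) (e₁ : + y₁ ≈ + z₁ [ 8 ]) (e₂ : + y₂ ≈ + z₂ [ 8 ]) where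

  private
    e₀⁻ = ≈-sym e₀
    e₁⁻ = ≈-sym e₁
    e₂⁻ = ≈-sym e₂

  N*-3-cong : N* y₀ y₁ y₂ 3 ≡ N* z₀ z₁ z₂ 3
  N*-3-cong = cong length (filter-≐ (counted? y₀ y₁ y₂) (counted? z₀ z₁ z₂)
    (counted-resp e₀ e₁ e₂ , counted-resp e₀⁻ e₁⁻ e₂⁻) (allTriples (2 ^ 3)))

  countIs-resp : ∀ u n → CountIs u n z₀ z₁ z₂ → CountIs u n y₀ y₁ y₂
  countIs-resp u n (c , c₀ , c₁ , c₂ , c₃) =
    c ∘ oddCase-resp e₀⁻ e₁⁻ e₂⁻ ,
    c₀ ∘ evenCase₀-resp e₀ e₁ e₂ ,
    c₁ ∘ evenCase₁-resp e₀ e₁ e₂ ,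
    c₂ ∘ evenCase₂-resp e₀ e₁ e₂ ,
    λ ¬o ¬e₀ ¬e₁ ¬e₂ → c₃ (¬o ∘ oddCase-resp e₀ e₁ e₂) (¬e₀ ∘ evenCase₀-resp e₀⁻ e₁⁻ e₂⁻)
      (¬e₁ ∘ evenCase₁-resp e₀⁻ e₁⁻ e₂⁻) (¬e₂ ∘ evenCase₂-resp e₀⁻ e₁⁻ e₂⁻)

-- The hypothesis is carried to the residues of y modulo 8, where the finite check applies, and both
-- the count and the case distinction are carried back.
N*-3 : ∀ y₀ y₁ y₂ → AtMostOneEven y₀ y₁ y₂ → CountIs 64 (N* y₀ y₁ y₂ 3) y₀ y₁ y₂
N*-3 y₀ y₁ y₂ h =
  let i , e₀ = residue y₀
      j , e₁ = residue y₁
      k , e₂ = residue y₂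
      h′ = atMostOneEven-resp (≈-sym e₀) (≈-sym e₁) (≈-sym e₂) h
  in subst (λ n → CountIs 64 n y₀ y₁ y₂) (sym (N*-3-cong e₀ e₁ e₂))
       (countIs-resp e₀ e₁ e₂ 64 (N* (toℕ i) (toℕ j) (toℕ k) 3) (N*-residues i j k h′))

-- From counts to densities

/-multiple : ∀ n k d .{{_ : NonZero d}} → n ≡ k * d → + n / d ≡ + k / 1
-- Unnormalised fractions are compared by cross-multiplication, which avoids computing a gcd. `mkℚᵘ`
-- stores the denominator minus one, so 0 stands for denominator 1.
/-multiple n k d@(suc d-1) n≡k*d = fromℚᵘ-cong {mkℚᵘ (+ n) d-1} {mkℚᵘ (+ k) 0}
  (*≡* (trans (ℤ.*-identityʳ (+ n)) (trans (cong +_ n≡k*d) (ℤ.pos-* k d))))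

lemma2 : (y₀ y₁ y₂ : ℕ) → 0 < y₀ → 0 < y₁ → 0 < y₂ → SquareFree (y₀ * y₁ * y₂) →
    (r : ℕ) → 3 ≤ r →
    (OddCase y₀ y₁ y₂ → N*/2^2r y₀ y₁ y₂ r ≡ + 1 / 1)
    × (EvenCase₀ y₀ y₁ y₂ → N*/2^2r y₀ y₁ y₂ r ≡ + 2 / 1)
    × (EvenCase₁ y₀ y₁ y₂ → N*/2^2r y₀ y₁ y₂ r ≡ + 2 / 1)
    × (EvenCase₂ y₀ y₁ y₂ → N*/2^2r y₀ y₁ y₂ r ≡ + 2 / 1)
    × (¬ OddCase y₀ y₁ y₂ → ¬ EvenCase₀ y₀ y₁ y₂ → ¬ EvenCase₁ y₀ y₁ y₂ → ¬ EvenCase₂ y₀ y₁ y₂ →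
    N*/2^2r y₀ y₁ y₂ r ≡ + 0 / 1)
lemma2 y₀ y₁ y₂ _ _ _ sf (suc (suc (suc k))) (s≤s (s≤s (s≤s z≤n))) =
  let c , c₀ , c₁ , c₂ , c₃ = N*-3 y₀ y₁ y₂ (squareFree⇒atMostOneEven y₀ y₁ y₂ sf) in
  density 1 ∘ c , density 2 ∘ c₀ , density 2 ∘ c₁ , density 2 ∘ c₂ ,
  λ ¬o ¬e₀ ¬e₁ ¬e₂ → density 0 (c₃ ¬o ¬e₀ ¬e₁ ¬e₂)
  where
  r = 3 + k
  density : ∀ t → N* y₀ y₁ y₂ 3 ≡ t * 64 → N*/2^2r y₀ y₁ y₂ r ≡ + t / 1
  density t N≡ = /-multiple (N* y₀ y₁ y₂ r) t (2 ^ (2 * r)) {{m^n≢0 2 (2 * r)}} (begin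
    N* y₀ y₁ y₂ r                      ≡⟨ N*-lift y₀ y₁ y₂ k ⟩
    2 ^ (2 * k) * N* y₀ y₁ y₂ 3        ≡⟨ cong (2 ^ (2 * k) *_) N≡ ⟩
    2 ^ (2 * k) * (t * 64)             ≡⟨ identity (2 ^ (2 * k)) t ⟩
    -- The 64 from modulus 8 is 2^6, and 6 + 2k = 2 (3 + k) is the exponent of the denominator.
    t * (64 * 2 ^ (2 * k))             ≡⟨ cong (t *_) (^-distribˡ-+-* 2 6 (2 * k)) ⟨
    t * 2 ^ (6 + 2 * k)                ≡⟨ cong (λ e → t * 2 ^ e) (*-distribˡ-+ 2 3 k) ⟨
    t * 2 ^ (2 * r)                    ∎)
    where
    identity : ∀ a t → a * (t * 64) ≡ t * (64 * a)
    identity = solve-∀
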